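{- The following equalities of functions hold: $$\mathrm{nat2fun}\circ\mathrm{fun2nat}=\mathrm{id}_{[\mathbb{N}]},\qquad \mathrm{fun2nat}\circ\mathrm{nat2fun}=\mathrm{id}_{\mathbb{N}}.$$
   Context: $\mathbb{N}=\{0,1,2,\dots\}$. $[\mathbb{N}]$ is the set of finite lists (possibly empty) of natural numbers; a list $[f(0),\dots,f(k-1)]$ represents the finite function $f:\{0,\dots,k-1\}\to\mathbb{N}$. $S$ is the set of finite subsets of $\mathbb{N}$, each represented by the strictly increasing list of its elements. $\mathrm{set2nat}:S\to\mathbb{N}$ is $\mathrm{set2nat}(X)=\sum_{x\in X}2^x$, and $\mathrm{nat2set}:\mathbb{N}\to S$ sends $n$ to the increasing list of positions $i\ge0$ at which the binary expansion of $n$ has digit $1$ (position $0$ is the least significant). $\mathrm{fun2set}:[\mathbb{N}]\to S$ is defined by $\mathrm{fun2set}([\,])=[\,]$ and $\mathrm{fun2set}([a_0,\dots,a_k])=[x_0,\dots,x_k]$ with $x_i=i+\sum_{j=0}^{i}a_j$. $\mathrm{set2fun}:S\to[\mathbb{N}]$ is defined by $\mathrm{set2fun}([\,])=[\,]$ and, for $x_0<\dots<x_k$, $\mathrm{set2fun}([x_0,\dots,x_k])=[x_0,\;x_1-x_0-1,\;\dots,\;x_k-x_{k-1}-1]$. Finally $\mathrm{nat2fun}:\mathbb{N}\to[\mathbb{N}]$ and $\mathrm{fun2nat}:[\mathbb{N}]\to\mathbb{N}$ are given by $\mathrm{nat2fun}(n)=\mathrm{set2fun}(\mathrm{nat2set}(n))$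 and $\mathrm{fun2nat}(\ell)=\mathrm{set2nat}(\mathrm{fun2set}(\ell))$. -}

module Defs where

open import Data.Bool.Base using (true; false)
open import Data.Digit using (1b; Expansion; toDigits)
open import Data.Fin.Base as Fin using (Fin; toℕ)
open import Data.Fin.Properties using (_≟_)
open import Data.List.Base
  using (List; []; _∷_; length; map; tabulate; take; zipWith; findIndices)
open import Data.List.Relation.Unary.All as All using ()
import Data.List.Relation.Unary.All.Properties as All
open import Data.List.Relation.Unary.AllPairs as AllPairs
  using (AllPairs; []; _∷_)
import Data.List.Relation.Unary.AllPairs.Properties as AllPairs
open import Data.List.Relation.Unary.Linked using (Linked)
open import Data.List.Relation.Unary.Linked.Properties using (AllPairs⇒Linked)
open import Data.Nat.Base
open import Data.Nat.ListAction using (sum)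
open import Data.Nat.Properties using (+-mono-<-≤; +-monoʳ-≤; <⇒≤)
open import Data.Product.Base using (proj₁)
open import Function.Base using (_∘_)
open import Relation.Nullary.Decidable.Core using (does)
open import Relation.Unary using (Pred; Decidable)

record S : Set where
  constructor mkS
  field
    elements   : List ℕ
    increasing : Linked _<_ elements

open S public

set2nat : S → ℕ
set2nat X = sum (map (2 ^_) (elements X))

findIndices-increasing : ∀ {a p} {A : Set a} {P : Pred A p} (P? : Decidable P)
                         (xs : List A) → AllPairs Fin._<_ (findIndices P? xs)
findIndices-increasing P? []       = []
findIndices-increasing P? (x ∷ xs) with does (P? x)
... | false = AllPairs.map⁺ (AllPairs.map s<s (findIndices-increasing P? xs))
... | true  = All.map⁺ (All.universal (λ _ → z<s) (findIndices P? xs))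
            ∷ AllPairs.map⁺ (AllPairs.map s<s (findIndices-increasing P? xs))

-- `toDigits` lists the least significant digit first, so the list index
-- of a digit is its position in the expansion.
binary : ℕ → Expansion 2
binary n = proj₁ (toDigits 2 n)

nat2set : ℕ → S
nat2set n = mkS (map toℕ (findIndices (_≟ 1b) (binary n)))
  (AllPairs⇒Linked (AllPairs.map⁺ (findIndices-increasing (_≟ 1b) (binary n))))

sum-take-mono-≤ : ∀ (l : List ℕ) {m n} → m ≤ n → sum (take m l) ≤ sum (take n l)
sum-take-mono-≤ l       z≤n       = z≤n
sum-take-mono-≤ []      (s≤s m≤n) = z≤n
sum-take-mono-≤ (a ∷ l) (s≤s m≤n) = +-monoʳ-≤ a (sum-take-mono-≤ l m≤n)

fun2set : List ℕ → S
fun2set l = mkS (tabulate x)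
  (AllPairs⇒Linked (AllPairs.tabulate⁺-<
    (λ i<j → +-mono-<-≤ i<j (sum-take-mono-≤ l (s≤s (<⇒≤ i<j))))))
  where
  x : Fin (length l) → ℕ
  x i = toℕ i + sum (take (suc (toℕ i)) l)

-- The truncated subtractions are exact because the elements of a member
-- of `S` are strictly increasing.
set2fun : S → List ℕ
set2fun (mkS []       _) = []
set2fun (mkS (x ∷ xs) _) = x ∷ zipWith (λ y z → z ∸ y ∸ 1) (x ∷ xs) xs

nat2fun : ℕ → List ℕ
nat2fun = set2fun ∘ nat2set

fun2nat : List ℕ → ℕ
fun2nat = set2nat ∘ fun2set

{-# OPTIONS --safe #-}

-- Shifting a set X by k multiplies set2nat X by 2 ^ k, so fun2nat satisfies
--   fun2nat (a ∷ l) ≡ 2 ^ a * (1 + 2 * fun2nat l),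
-- and it is injective because the factorisation of a positive number into
-- a power of two and an odd number is unique.  As fun2nat ∘ nat2fun is the
-- identity (partial sums undo differences, and a number is the sum of the
-- powers of two at its nonzero digits), injectivity gives the other equality.
module Submission where

open import Defs
open import Data.Digit using (1b; Expansion; fromDigits; toDigits)
open import Data.Fin.Base using (zero; suc; toℕ)
open import Data.Fin.Properties using (_≟_)
open import Data.List.Base
  using (List; []; _∷_; map; tabulate; take; zipWith; findIndices)
open import Data.List.Properties
  using (map-∘; map-cong; map-tabulate; tabulate-cong)
open import Data.List.Relation.Unary.Linked using (Linked; [-]; _∷_)
open import Data.Nat.Base
open import Data.Nat.ListAction using (sum)
open import Data.Nat.Properties hiding (_≟_)
open import Data.Nat.Tactic.RingSolver using (solve-∀)
open import Data.Product.Base using (_×_; _,_; proj₂)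
open import Function.Base using (_∘_; id)
open import Function.Definitions using (Injective)
open import Relation.Binary.PropositionalEquality
  using (_≡_; _≗_; refl; sym; trans; cong; cong₂; module ≡-Reasoning)
open import Relation.Nullary.Negation using (contradiction)

open ≡-Reasoning

sum-2^-shift : ∀ k xs →
  sum (map (2 ^_) (map (k +_) xs)) ≡ 2 ^ k * sum (map (2 ^_) xs)
sum-2^-shift k []       = sym (*-zeroʳ (2 ^ k))
sum-2^-shift k (x ∷ xs) = begin
  2 ^ (k + x) + sum (map (2 ^_) (map (k +_) xs))
    ≡⟨ cong₂ _+_ (^-distribˡ-+-* 2 k x) (sum-2^-shift k xs) ⟩
  2 ^ k * 2 ^ x + 2 ^ k * sum (map (2 ^_) xs)
    ≡⟨ *-distribˡ-+ (2 ^ k) (2 ^ x) _ ⟨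
  2 ^ k * (2 ^ x + sum (map (2 ^_) xs)) ∎

-- Prepending `a` raises the index of every later entry by one and adds `a` to its partial sum, so
-- the later elements move up by `suc a`.
elements-fun2set-∷ : ∀ a l →
  elements (fun2set (a ∷ l)) ≡ a ∷ map (suc a +_) (elements (fun2set l))
elements-fun2set-∷ a l = cong₂ _∷_ (+-identityʳ a) (begin
  tabulate (λ i → suc (toℕ i) + (a + sum (take (suc (toℕ i)) l)))
    ≡⟨ tabulate-cong (λ i → cong suc (x∙yz≈y∙xz (toℕ i) a _)) ⟩
  tabulate (λ i → suc a + (toℕ i + sum (take (suc (toℕ i)) l)))
    ≡⟨ map-tabulate _ (suc a +_) ⟨
  map (suc a +_) (elements (fun2set l)) ∎)
  where open import Algebra.Properties.CommutativeSemigroup +-commutativeSemigroup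
          using (x∙yz≈y∙xz)

fun2nat-∷ : ∀ a l → fun2nat (a ∷ l) ≡ 2 ^ a * suc (2 * fun2nat l)
fun2nat-∷ a l = begin
  fun2nat (a ∷ l)
    ≡⟨ cong (sum ∘ map (2 ^_)) (elements-fun2set-∷ a l) ⟩
  2 ^ a + sum (map (2 ^_) (map (suc a +_) (elements (fun2set l))))
    ≡⟨ cong (2 ^ a +_) (sum-2^-shift (suc a) (elements (fun2set l))) ⟩
  2 ^ a + 2 * 2 ^ a * fun2nat l
    ≡⟨ factor (2 ^ a) (fun2nat l) ⟩
  2 ^ a * suc (2 * fun2nat l) ∎
  where
  factor : ∀ p n → p + 2 * p * n ≡ p * suc (2 * n)
  factor = solve-∀

-- Induction on both exponents: while both are positive a factor 2 cancels, and if just one is zero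
-- an odd number would equal an even one.
2^a*odd-injective : ∀ a b {m n} →
  2 ^ a * suc (2 * m) ≡ 2 ^ b * suc (2 * n) → a ≡ b × m ≡ n
2^a*odd-injective zero zero {m} {n} eq =
  refl , *-cancelˡ-≡ m n 2 (suc-injective (*-cancelˡ-≡ _ _ 1 eq))
2^a*odd-injective zero (suc b) {m} {n} eq =
  contradiction
    (trans (sym (*-assoc 2 (2 ^ b) _)) (trans (sym eq) (*-identityˡ _)))
    (even≢odd (2 ^ b * suc (2 * n)) m)
2^a*odd-injective (suc a) zero {m} {n} eq =
  contradiction
    (trans (sym (*-assoc 2 (2 ^ a) _)) (trans eq (*-identityˡ _)))
    (even≢odd (2 ^ a * suc (2 * m)) n)
2^a*odd-injective (suc a) (suc b) eq
  with refl , m≡n ← 2^a*odd-injective a b (*-cancelˡ-≡ _ _ 2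
    (trans (sym (*-assoc 2 (2 ^ a) _)) (trans eq (*-assoc 2 (2 ^ b) _))))
  = refl , m≡n

fun2nat-∷≢0 : ∀ a l → NonZero (fun2nat (a ∷ l))
fun2nat-∷≢0 a l rewrite fun2nat-∷ a l = m*n≢0 _ _ {{m^n≢0 2 a}}

-- Heads are recovered as exponents, tails recursively from the odd parts; `[]` is the only list
-- sent to 0.
fun2nat-injective : Injective _≡_ _≡_ fun2nat
fun2nat-injective {[]}    {[]}    eq = refl
fun2nat-injective {[]}    {b ∷ m} eq =
  contradiction (sym eq) (≢-nonZero⁻¹ _ {{fun2nat-∷≢0 b m}})
fun2nat-injective {a ∷ l} {[]}    eq =
  contradiction eq (≢-nonZero⁻¹ _ {{fun2nat-∷≢0 a l}})
fun2nat-injective {a ∷ l} {b ∷ m} eq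
  with a≡b , l≡m ← 2^a*odd-injective a b
    (trans (sym (fun2nat-∷ a l)) (trans eq (fun2nat-∷ b m)))
  = cong₂ _∷_ a≡b (fun2nat-injective l≡m)

-- The tail of `set2fun`, on bare lists: at `y ∷ ys` it unfolds to one gap followed by `gaps y ys`,
-- so induction can run without the record `S`.
gaps : ℕ → List ℕ → List ℕ
gaps x xs = zipWith (λ y z → z ∸ y ∸ 1) (x ∷ xs) xs

-- The offset `suc x` is what the gaps forget. Past the first gap `g` it grows to `suc x + suc g`,
-- which is `suc y`, the offset in the induction hypothesis at `y`.
shift-fun2set-gaps : ∀ {x xs} → Linked _<_ (x ∷ xs) →
  map (suc x +_) (elements (fun2set (gaps x xs))) ≡ xs
shift-fun2set-gaps [-] = refl
shift-fun2set-gaps {x} {y ∷ ys} (x<y ∷ inc) = begin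
  map (suc x +_) (elements (fun2set (g ∷ gs)))
    ≡⟨ cong (map (suc x +_)) (elements-fun2set-∷ g gs) ⟩
  suc x + g ∷ map (suc x +_) (map (suc g +_) (elements (fun2set gs)))
    ≡⟨ cong₂ _∷_ 1+x+g≡y (sym (map-∘ (elements (fun2set gs)))) ⟩
  y ∷ map (λ i → suc x + (suc g + i)) (elements (fun2set gs))
    ≡⟨ cong (y ∷_) (map-cong shift (elements (fun2set gs))) ⟩
  y ∷ map (suc y +_) (elements (fun2set gs))
    ≡⟨ cong (y ∷_) (shift-fun2set-gaps inc) ⟩
  y ∷ ys ∎
  where
  g  = y ∸ x ∸ 1
  gs = gaps y ys

  1+x+g≡y : suc x + g ≡ y
  1+x+g≡y = begin
    suc x + (y ∸ x ∸ 1)    ≡⟨ cong (suc x +_) (∸-+-assoc y x 1) ⟩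
    suc x + (y ∸ (x + 1))  ≡⟨ cong (λ k → suc x + (y ∸ k)) (+-comm x 1) ⟩
    -- `x<y` unfolds to `suc x ≤ y`, so this subtraction is exact.
    suc x + (y ∸ suc x)    ≡⟨ m+[n∸m]≡n x<y ⟩
    y                      ∎

  shift : ∀ i → suc x + (suc g + i) ≡ suc y + i
  shift i = begin
    suc x + (suc g + i)    ≡⟨ +-suc (suc x) (g + i) ⟩
    suc (suc x + (g + i))  ≡⟨ cong suc (+-assoc (suc x) g i) ⟨
    suc (suc x + g + i)    ≡⟨ cong (λ k → suc (k + i)) 1+x+g≡y ⟩
    suc y + i              ∎

-- Compared at the level of element lists, which is all that `set2nat` reads; an equation in `S`
-- would also have to match the proofs of increase.
elements-fun2set-set2fun : ∀ X → elements (fun2set (set2fun X)) ≡ elements X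
elements-fun2set-set2fun (mkS []       _)   = refl
elements-fun2set-set2fun (mkS (x ∷ xs) inc) =
  trans (elements-fun2set-∷ x (gaps x xs)) (cong (x ∷_) (shift-fun2set-gaps inc))

-- Horner's scheme: a new lowest digit shifts all other indices by one, which doubles their sum.
sum-2^-findIndices : ∀ (ds : Expansion 2) →
  sum (map (2 ^_) (map toℕ (findIndices (_≟ 1b) ds))) ≡ fromDigits ds
sum-2^-findIndices []       = refl
sum-2^-findIndices (d ∷ ds) = helper d
  where
  indices = findIndices (_≟ 1b) ds

  tail : sum (map (2 ^_) (map toℕ (map suc indices))) ≡ fromDigits ds * 2
  tail = begin
    sum (map (2 ^_) (map toℕ (map suc indices)))
      -- Both double maps fuse to the same map, since `toℕ (suc i)` reduces to `suc (toℕ i)`.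
      ≡⟨ cong (sum ∘ map (2 ^_)) (trans (sym (map-∘ indices)) (map-∘ indices)) ⟩
    sum (map (2 ^_) (map suc (map toℕ indices)))
      ≡⟨ sum-2^-shift 1 (map toℕ indices) ⟩
    2 * sum (map (2 ^_) (map toℕ indices))
      ≡⟨ cong (2 *_) (sum-2^-findIndices ds) ⟩
    2 * fromDigits ds
      ≡⟨ *-comm 2 (fromDigits ds) ⟩
    fromDigits ds * 2 ∎

  helper : ∀ d → sum (map (2 ^_) (map toℕ (findIndices (_≟ 1b) (d ∷ ds))))
               ≡ fromDigits (d ∷ ds)
  -- Matching on the digit lets the test `_≟ 1b` compute: 0 contributes no index, 1 contributes
  -- index 0 and hence the summand 1.
  helper zero       = tail
  helper (suc zero) = cong suc tail

set2nat-nat2set : set2nat ∘ nat2set ≗ id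
set2nat-nat2set n =
  trans (sum-2^-findIndices (binary n)) (proj₂ (toDigits 2 n))

fun2nat-nat2fun : fun2nat ∘ nat2fun ≗ id
fun2nat-nat2fun n =
  trans (cong (sum ∘ map (2 ^_)) (elements-fun2set-set2fun (nat2set n)))
        (set2nat-nat2set n)

proposition4 : (nat2fun ∘ fun2nat ≗ id) × (fun2nat ∘ nat2fun ≗ id)
proposition4 =
  (λ l → fun2nat-injective (fun2nat-nat2fun (fun2nat l))) , fun2nat-nat2fun
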